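{- Let $\mathcal{G}=(V,E)$ be a directed acyclic graph on $V=\{1,\ldots,n\}$ such that every edge $(i,j)\in E$ satisfies $i<j$. Let $X=\{e_1,\ldots,e_m\}$ be a set of $m\ge n$ distinct elements, let every agent $i\in V$ have strategy set $X_i=X$, and let $$f(x_1,\ldots,x_n)=\Big|\bigcup_{i}\{x_i\}\Big|$$ be the number of distinct elements chosen. Let $x_1,\ldots,x_n$ be produced by the greedy algorithm in which, sequentially for $i=1,\ldots,n$, agent $i$ chooses the element $x_i=e_j$ of smallest index $j$ such that $e_j\notin X_{\mathrm{in}}(i)$, where $X_{\mathrm{in}}(i)=\{x_l:(l,i)\in E\}$. If this greedy algorithm finds a solution within $k/n$ of the optimal for some integer $k>0$, i.e. $f(x_1,\ldots,x_n)\ge \frac{k}{n}\max_{y_1,\ldots,y_n\in X} f(y_1,\ldots,y_n)$, then each of the following properties holds: (i) there is a vertex in $\mathcal{G}$ with in-degree at least $k-1$; (ii) for each $\ell\in\{1,\ldots,k\}$ there are at least $\ell$ agents (vertices) with in-degree at least $k-\ell$; (iii) the number of edges in $\mathcal{G}$ is at least $k(k-1)/2$.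
   Context: The in-degree of vertex $i$ is the number of $j\in V$ with $(j,i)\in E$. The rule for $x_i$ is the greedy rule of maximizing the marginal reward, which equals $1$ for elements $e_j\notin X_{\mathrm{in}}(i)$ and $0$ for elements $e_j\in X_{\mathrm{in}}(i)$, with ties broken by choosing the lowest index. -}

module Defs where

open import Data.Nat using (ℕ) renaming (_≤_ to _≤ᴺ_; _≤?_ to _≤ᴺ?_)
open import Data.Fin using (Fin; _≤_; _<_)
open import Data.Fin.Subset using (Subset; ⋃; ⁅_⁆; ∣_∣; _∉_)
open import Data.List using (List; length; map; filter; allFin; cartesianProduct)
open import Data.Product using (∃; _×_; uncurry)
open import Function using (_∘_)
open import Level using (Level; 0ℓ)
open import Relation.Binary using (Rel; Decidable)
open import Relation.Binary.Construct.Closure.Transitive using (TransClosure)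
open import Relation.Binary.PropositionalEquality using (_≡_)
open import Relation.Nullary using (¬_)

private
  variable
    a : Level
    n m : ℕ

record DAG (n : ℕ) : Set₁ where
  field
    Edge    : Rel (Fin n) 0ℓ
    edge?   : Decidable Edge
    acyclic : ∀ {i} → ¬ TransClosure Edge i i

open DAG public

RespectsOrder : DAG n → Set
RespectsOrder G = ∀ {i j} → Edge G i j → i < j

inNeighbours : DAG n → Fin n → List (Fin n)
inNeighbours {n} G i = filter (λ j → edge? G j i) (allFin n)

inDegree : DAG n → Fin n → ℕ
inDegree G i = length (inNeighbours G i)

verticesWithInDegree≥ : ℕ → DAG n → List (Fin n)
verticesWithInDegree≥ {n} d G = filter (λ i → d ≤ᴺ? inDegree G i) (allFin n)

edges : DAG n → List (Fin n × Fin n)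
edges {n} G = filter (uncurry (edge? G)) (cartesianProduct (allFin n) (allFin n))

-- The ground set X = {e₁,…,eₘ} is Fin m, each element being identified with
-- its index, so that subsets of X are Subset m and the order on indices is the
-- order of Fin m.
Assignment : ℕ → ℕ → Set
Assignment n m = Fin n → Fin m

f : Assignment n m → ℕ
f {n} x = ∣ ⋃ (map (⁅_⁆ ∘ x) (allFin n)) ∣

Xin : DAG n → Assignment n m → Fin n → Subset m
Xin G x i = ⋃ (map (⁅_⁆ ∘ x) (inNeighbours G i))

-- When edges respect the vertex order, Xin G x i depends only on the choices of
-- agents before i, so for n ≤ m these conditions determine exactly one x: the
-- output of the sequential algorithm.
IsGreedy : DAG n → Assignment n m → Set
IsGreedy G x = ∀ i → x i ∉ Xin G x i × (∀ j → j ∉ Xin G x i → x i ≤ j)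

IsMaximumOf : {A : Set a} → (A → ℕ) → ℕ → Set a
IsMaximumOf g v = (∃ λ y → g y ≡ v) × (∀ y → g y ≤ᴺ v)

{-# OPTIONS --safe #-}

-- Since n ≤ m, the optimum is at least n, so the greedy choice uses at least k
-- elements, and hence some element of (0-based) index at least k ∸ 1.  An agent
-- choosing the element of index p sees every smaller index among its
-- in-neighbours, so its in-degree is at least p, and every index below k is
-- chosen by some agent.  The edges contain, for each pair a < b < k, one from an
-- agent choosing a to an agent choosing b.
module Submission where

open import Data.Nat using (ℕ; NonZero; _≤_; _<_; _∸_; _*_; _/_)
open import Data.Fin using (Fin)
open import Data.Integer using (+_)
open import Data.List using (length)
open import Data.Product using (_×_; ∃)
open import Data.Rational using () renaming (_/_ to _/ℚ_; _*_ to _*ℚ_; _≤_ to _≤ℚ_)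
open import Defs

open import Data.Nat using (zero; suc; s≤s; z≤n; z<s; s<s; _+_; s<s⁻¹)
open import Data.Nat.DivMod using (m*n/n≡m; /-congˡ)
open import Data.Nat.Properties
open import Data.Fin using (zero; suc; toℕ; fromℕ<; inject≤)
open import Data.Fin.Properties using (toℕ<n; toℕ-fromℕ<; toℕ-inject≤; toℕ-injective; injective⇒≤)
open import Data.Fin.Subset using (Subset; inside; outside; _∈_; ∣_∣; ⋃; ⁅_⁆)
open import Data.Fin.Subset.Properties using (_∈?_; ∉⊥; x∈p∪q⁻; x∈p∪q⁺; x∈⁅y⁆⇒x≡y; x∈⁅x⁆)
import Data.Integer as ℤ
import Data.Integer.Properties as ℤ
open import Data.List using (List; []; _∷_; _++_; map; lookup; allFin; upTo; applyUpTo)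
open import Data.List.Properties using (length-map; length-++; length-upTo; length-applyUpTo)
open import Data.List.Membership.Propositional using () renaming (_∈_ to _∈ᴸ_)
open import Data.List.Membership.Propositional.Properties
open import Data.List.Membership.Setoid.Properties using (index-injective)
import Data.List.Relation.Unary.All as All
open import Data.List.Relation.Unary.AllPairs using ([]; _∷_)
open import Data.List.Relation.Unary.Any using (here; there; index)
open import Data.List.Relation.Unary.Unique.Propositional using (Unique)
import Data.List.Relation.Unary.Unique.Propositional.Properties as Unique
open import Data.List.Relation.Binary.Subset.Propositional using (_⊆_)
open import Data.Product using (_,_; proj₁; proj₂; uncurry)
open import Data.Product.Properties using (,-injectiveˡ)
open import Data.Rational using (toℚᵘ)
open import Data.Rational.Properties using (toℚᵘ-mono-≤; toℚᵘ-homo-*; toℚᵘ-fromℚᵘ)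
open import Data.Rational.Unnormalised as ℚᵘ using (mkℚᵘ)
import Data.Rational.Unnormalised.Properties as ℚᵘ
open import Data.Sum using (inj₁; inj₂)
open import Data.Vec.Base using ([]; _∷_; here; there)
open import Function using (_∘_; _$_)
open import Relation.Binary.PropositionalEquality
open import Relation.Nullary using (contradiction)
open import Relation.Nullary.Decidable using (decidable-stable)

private
  variable
    A B : Set
    n m : ℕ

lookup-injective : {xs : List A} → Unique xs → ∀ i j → lookup xs i ≡ lookup xs j → i ≡ j
lookup-injective (_  ∷ _) zero    zero    _  = refl
lookup-injective (x≢ ∷ _) zero    (suc j) eq = contradiction eq (All.lookup x≢ (∈-lookup j))
lookup-injective (x≢ ∷ _) (suc i) zero    eq = contradiction (sym eq) (All.lookup x≢ (∈-lookup i))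
lookup-injective (_  ∷ u) (suc i) (suc j) eq = cong suc (lookup-injective u i j eq)

-- Pigeonhole: sending each position of `ys` to the position in `xs` where its entry is found is
-- injective, since `ys` has no repetitions.
unique-⊆⇒length≤ : {xs ys : List A} → Unique ys → ys ⊆ xs → length ys ≤ length xs
unique-⊆⇒length≤ {A} {xs} {ys} u ys⊆xs = injective⇒≤ {f = λ i → index (ys⊆xs (∈-lookup i))}
  λ {i} {j} eq → lookup-injective u i j
    (index-injective (setoid A) (ys⊆xs (∈-lookup i)) (ys⊆xs (∈-lookup j)) eq)

-- The common form of the three counts below: in-neighbours, agents and edges are labelled by the
-- indices chosen, and distinct labels that all occur bound the length.
unique-⊆-map⇒length≤ : (g : B → A) {xs : List B} {ys : List A} →
  Unique ys → ys ⊆ map g xs → length ys ≤ length xs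
unique-⊆-map⇒length≤ g {xs} u ys⊆ = subst (_ ≤_) (length-map g xs) (unique-⊆⇒length≤ u ys⊆)

pairsBelow : ℕ → List (ℕ × ℕ)
pairsBelow zero    = []
pairsBelow (suc k) = map (_, k) (upTo k) ++ pairsBelow k

∈-pairsBelow⁻ : ∀ k {a b} → (a , b) ∈ᴸ pairsBelow k → a < b × b < k
∈-pairsBelow⁻ (suc k) p with ∈-++⁻ (map (_, k) (upTo k)) p
... | inj₁ q with _ , a∈ , refl ← ∈-map⁻ (_, k) q = ∈-upTo⁻ a∈ , n<1+n k
... | inj₂ q with a<b , b<k ← ∈-pairsBelow⁻ k q = a<b , m<n⇒m<1+n b<k

pairsBelow-unique : ∀ k → Unique (pairsBelow k)
pairsBelow-unique zero    = []
pairsBelow-unique (suc k) = Unique.++⁺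
  (Unique.map⁺ ,-injectiveˡ (Unique.upTo⁺ k))
  (pairsBelow-unique k)
  -- The blocks are disjoint: the second entry is `k` in the first block and below `k` in the other.
  λ (p , q) → <-irrefl (second p) (proj₂ (∈-pairsBelow⁻ k q))
  where
  second : ∀ {ab} → ab ∈ᴸ map (_, k) (upTo k) → proj₂ ab ≡ k
  second p with _ , _ , refl ← ∈-map⁻ (_, k) p = refl

-- Doubling avoids division, and the shift to `suc k` avoids truncated subtraction.
length-pairsBelow : ∀ k → length (pairsBelow (suc k)) * 2 ≡ suc k * k
length-pairsBelow zero    = refl
length-pairsBelow (suc k) = begin
  length (map (_, suc k) (upTo (suc k)) ++ pairsBelow (suc k)) * 2
    ≡⟨ cong (_* 2) (length-++ (map (_, suc k) (upTo (suc k)))) ⟩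
  (length (map (_, suc k) (upTo (suc k))) + length (pairsBelow (suc k))) * 2
    ≡⟨ cong (λ l → (l + length (pairsBelow (suc k))) * 2)
         (trans (length-map (_, suc k) (upTo (suc k))) (length-upTo (suc k))) ⟩
  (suc k + length (pairsBelow (suc k))) * 2
    ≡⟨ *-distribʳ-+ 2 (suc k) _ ⟩
  suc k * 2 + length (pairsBelow (suc k)) * 2
    ≡⟨ cong (_+_ (suc k * 2)) (length-pairsBelow k) ⟩
  suc k * 2 + suc k * k
    ≡⟨ *-distribˡ-+ (suc k) 2 k ⟨
  suc k * suc (suc k)
    ≡⟨ *-comm (suc k) (suc (suc k)) ⟩
  suc (suc k) * suc k ∎
  where open ≡-Reasoning

∈-⋃-map⁻ : (x : A → Fin m) (as : List A) {j : Fin m} → j ∈ ⋃ (map (⁅_⁆ ∘ x) as) →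
  ∃ λ a → a ∈ᴸ as × x a ≡ j
∈-⋃-map⁻ x []       j∈ = contradiction j∈ ∉⊥
∈-⋃-map⁻ x (a ∷ as) j∈ with x∈p∪q⁻ ⁅ x a ⁆ _ j∈
... | inj₁ j∈xa = a , here refl , sym (x∈⁅y⁆⇒x≡y (x a) j∈xa)
... | inj₂ j∈as with b , b∈as , eq ← ∈-⋃-map⁻ x as j∈as = b , there b∈as , eq

∈-⋃-map⁺ : (x : A → Fin m) {as : List A} {a : A} → a ∈ᴸ as → x a ∈ ⋃ (map (⁅_⁆ ∘ x) as)
∈-⋃-map⁺ x (here refl) = x∈p∪q⁺ (inj₁ (x∈⁅x⁆ _))
∈-⋃-map⁺ x (there a∈) = x∈p∪q⁺ (inj₂ (∈-⋃-map⁺ x a∈))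

-- Only `c` indices lie below `c`, so a subset with more than `c` elements reaches beyond them.
<∣p∣⇒∃large : ∀ {c} (p : Subset m) → c < ∣ p ∣ → ∃ λ i → i ∈ p × c ≤ toℕ i
<∣p∣⇒∃large (outside ∷ p) c< with i , i∈p , c≤i ← <∣p∣⇒∃large p c< =
  suc i , there i∈p , m≤n⇒m≤1+n c≤i
<∣p∣⇒∃large {c = zero}  (inside ∷ p) c< = zero , here , z≤n
<∣p∣⇒∃large {c = suc c} (inside ∷ p) c< with i , i∈p , c≤i ← <∣p∣⇒∃large p (s<s⁻¹ c<) =
  suc i , there i∈p , s≤s c≤i

initial⊆p⇒≤∣p∣ : n ≤ m → (p : Subset m) → (∀ i → toℕ i < n → i ∈ p) → n ≤ ∣ p ∣
initial⊆p⇒≤∣p∣ z≤n       p       init = z≤n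
-- Matching `here` forces the head to be `inside`, so it contributes one to the size.
initial⊆p⇒≤∣p∣ (s≤s n≤m) (s ∷ p) init with here ← init zero z<s =
  s≤s (initial⊆p⇒≤∣p∣ n≤m p λ i i<n → drop (init (suc i) (s<s i<n)))
  where
  drop : ∀ {i} → suc i ∈ (inside ∷ p) → i ∈ p
  drop (there i∈p) = i∈p

-- The assignment `ι`, in which each agent takes the element of its own index, already covers the
-- first `n` elements.
n≤maximum : n ≤ m → ∀ {opt} → IsMaximumOf (f {n} {m}) opt → n ≤ opt
n≤maximum {n} {m} n≤m (_ , bound) = ≤-trans (initial⊆p⇒≤∣p∣ n≤m _ covered) (bound ι)
  where
  ι : Assignment n m
  ι i = inject≤ i n≤m

  covered : ∀ j → toℕ j < n → j ∈ ⋃ (map (⁅_⁆ ∘ ι) (allFin n))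
  covered j j<n = subst (_∈ _)
    (toℕ-injective (trans (toℕ-inject≤ (fromℕ< j<n) n≤m) (toℕ-fromℕ< j<n)))
    (∈-⋃-map⁺ ι (∈-allFin (fromℕ< j<n)))

-- Clears denominators. Normalisation in `/ℚ` hides numerators and denominators behind a gcd, so the
-- inequality is moved to unnormalised rationals, where it unfolds to cross-multiplication.
ratio-bound⇒*≤* : ∀ n .{{_ : NonZero n}} k a b →
  ((+ k) /ℚ n) *ℚ ((+ a) /ℚ 1) ≤ℚ ((+ b) /ℚ 1) → k * a ≤ b * n
ratio-bound⇒*≤* n@(suc n-1) k a b ineq = ℤ.drop‿+≤+ (subst₂ ℤ._≤_ lhs rhs (ℚᵘ.drop-*≤* ineqᵘ))
  where
  ineqᵘ : mkℚᵘ (+ k) n-1 ℚᵘ.* mkℚᵘ (+ a) 0 ℚᵘ.≤ mkℚᵘ (+ b) 0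
  ineqᵘ = begin
    mkℚᵘ (+ k) n-1 ℚᵘ.* mkℚᵘ (+ a) 0
      ≃⟨ ℚᵘ.*-cong (toℚᵘ-fromℚᵘ (mkℚᵘ (+ k) n-1)) (toℚᵘ-fromℚᵘ (mkℚᵘ (+ a) 0)) ⟨
    toℚᵘ ((+ k) /ℚ n) ℚᵘ.* toℚᵘ ((+ a) /ℚ 1)
      ≃⟨ toℚᵘ-homo-* ((+ k) /ℚ n) ((+ a) /ℚ 1) ⟨
    toℚᵘ (((+ k) /ℚ n) *ℚ ((+ a) /ℚ 1))
      ≤⟨ toℚᵘ-mono-≤ ineq ⟩
    toℚᵘ ((+ b) /ℚ 1)
      ≃⟨ toℚᵘ-fromℚᵘ (mkℚᵘ (+ b) 0) ⟩
    mkℚᵘ (+ b) 0 ∎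
    where open ℚᵘ.≤-Reasoning

  lhs : (+ k) ℤ.* (+ a) ℤ.* (+ 1) ≡ + (k * a)
  lhs = trans (ℤ.*-identityʳ _) (sym (ℤ.pos-* k a))

  rhs : (+ b) ℤ.* (+ (n * 1)) ≡ + (b * n)
  rhs = trans (sym (ℤ.pos-* b (n * 1))) (cong (λ d → + (b * d)) (*-identityʳ n))

module Greedy (G : DAG n) (x : Assignment n m) (greedy : IsGreedy G x) where

  -- If the element of index `p` were missing from `Xin G x i`, minimality of the greedy choice
  -- would give `toℕ (x i) ≤ p`.
  smaller-chosen : ∀ i {p} → p < toℕ (x i) → ∃ λ l → l ∈ᴸ inNeighbours G i × toℕ (x l) ≡ p
  smaller-chosen i {p} p<xi =
    let l , l∈ , eq = ∈-⋃-map⁻ x (inNeighbours G i) j∈Xin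
    in l , l∈ , trans (cong toℕ eq) (toℕ-fromℕ< p<m)
    where
    p<m : p < m
    p<m = <-trans p<xi (toℕ<n (x i))

    j∈Xin : fromℕ< p<m ∈ Xin G x i
    j∈Xin = decidable-stable (fromℕ< p<m ∈? Xin G x i) λ j∉ →
      <⇒≱ p<xi (subst (toℕ (x i) ≤_) (toℕ-fromℕ< p<m) (proj₂ (greedy i) _ j∉))

  choice≤inDegree : ∀ i → toℕ (x i) ≤ inDegree G i
  choice≤inDegree i = subst (_≤ inDegree G i) (length-upTo (toℕ (x i)))
    (unique-⊆-map⇒length≤ (toℕ ∘ x) (Unique.upTo⁺ (toℕ (x i))) included)
    where
    included : upTo (toℕ (x i)) ⊆ map (toℕ ∘ x) (inNeighbours G i)
    included p∈ with l , l∈ , refl ← smaller-chosen i (∈-upTo⁻ p∈) = ∈-map⁺ (toℕ ∘ x) l∈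

  large-chosen : ∀ {c} → c < f x → ∃ λ i → c ≤ toℕ (x i)
  large-chosen c<f with j , j∈ , c≤j ← <∣p∣⇒∃large _ c<f
                   with i , _ , refl ← ∈-⋃-map⁻ x (allFin n) j∈ = i , c≤j

  -- The chosen indices are downward closed: an agent whose choice is at least `p` either chooses
  -- `p` itself or has an in-neighbour that does.
  chosen : ∀ {p} → p < f x → ∃ λ i → toℕ (x i) ≡ p
  chosen p<f with i , p≤xi ← large-chosen p<f with m≤n⇒m<n∨m≡n p≤xi
  ... | inj₂ p≡xi = i , sym p≡xi
  ... | inj₁ p<xi with l , _ , eq ← smaller-chosen i p<xi = l , eq

  -- The agents found for the indices `d`, ..., `d + ℓ - 1` are distinct, and each has in-degree at
  -- least the index it chooses, hence at least `d`.
  many-large-inDegree : ∀ d ℓ → d + ℓ ≤ f x → ℓ ≤ length (verticesWithInDegree≥ d G)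
  many-large-inDegree d ℓ d+ℓ≤f = subst (_≤ _) (length-applyUpTo (_+_ d) ℓ)
    (unique-⊆-map⇒length≤ (toℕ ∘ x)
      (Unique.applyUpTo⁺₁ (_+_ d) ℓ λ i<j _ eq → <⇒≢ i<j (+-cancelˡ-≡ d _ _ eq))
      included)
    where
    included : applyUpTo (_+_ d) ℓ ⊆ map (toℕ ∘ x) (verticesWithInDegree≥ d G)
    included p∈ with i , i<ℓ , refl ← ∈-applyUpTo⁻ (_+_ d) p∈
                with v , eq ← chosen (<-≤-trans (+-monoʳ-< d i<ℓ) d+ℓ≤f) =
      subst (_∈ᴸ _) eq $ ∈-map⁺ (toℕ ∘ x) $
        ∈-filter⁺ (λ v → d ≤? inDegree G v) (∈-allFin v)
          (≤-trans (m≤m+n d i) (subst (_≤ _) eq (choice≤inDegree v)))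

  pairs≤edges : ∀ {k} → k ≤ f x → length (pairsBelow k) ≤ length (edges G)
  pairs≤edges {k} k≤f = unique-⊆-map⇒length≤ ends (pairsBelow-unique k) included
    where
    ends : Fin n × Fin n → ℕ × ℕ
    ends (u , v) = toℕ (x u) , toℕ (x v)

    included : pairsBelow k ⊆ map ends (edges G)
    -- The larger index comes first: `v` chooses `b`, and then `u` is an in-neighbour of `v`
    -- choosing `a`, so the edge runs from `u` to `v`.
    included ab∈ with a<b , b<k ← ∈-pairsBelow⁻ k ab∈
                 with v , refl ← chosen (<-≤-trans b<k k≤f)
                 with u , u∈ , refl ← smaller-chosen v a<b =
      ∈-map⁺ ends $ ∈-filter⁺ (uncurry (edge? G))
        (∈-cartesianProduct⁺ (∈-allFin u) (∈-allFin v))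
        (proj₂ (∈-filter⁻ (λ j → edge? G j v) {xs = allFin n} u∈))

propositionV2 : ∀ {n m : ℕ} .{{_ : NonZero n}} (G : DAG n) → RespectsOrder G →
    n ≤ m →
    (x : Assignment n m) → IsGreedy G x →
    (opt : ℕ) → IsMaximumOf (f {n} {m}) opt →
    (k : ℕ) → 0 < k →
    ((+ k) /ℚ n) *ℚ ((+ opt) /ℚ 1) ≤ℚ ((+ (f x)) /ℚ 1) →
    (∃ λ (i : Fin n) → k ∸ 1 ≤ inDegree G i)
    × (∀ (ℓ : ℕ) → 1 ≤ ℓ → ℓ ≤ k → ℓ ≤ length (verticesWithInDegree≥ (k ∸ ℓ) G))
    × ((k * (k ∸ 1)) / 2 ≤ length (edges G))
propositionV2 {n} G _ n≤m x greedy opt isMax k@(suc k-1) _ ratio =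
    -- As `k` is `suc k-1`, `k≤f` also reads `k-1 < f x`.
    (let i , k-1≤xi = large-chosen k≤f in i , ≤-trans k-1≤xi (choice≤inDegree i))
  , (λ ℓ _ ℓ≤k → many-large-inDegree (k ∸ ℓ) ℓ (subst (_≤ f x) (sym (m∸n+n≡m ℓ≤k)) k≤f))
  , subst (_≤ length (edges G)) triangle (pairs≤edges k≤f)
  where
  open Greedy G x greedy

  -- Cancel `n` from `k * n ≤ k * opt ≤ f x * n`.
  k≤f : k ≤ f x
  k≤f = *-cancelʳ-≤ k (f x) n
    (≤-trans (*-monoʳ-≤ k (n≤maximum n≤m isMax)) (ratio-bound⇒*≤* n k opt (f x) ratio))

  triangle : length (pairsBelow k) ≡ k * k-1 / 2
  triangle = trans (sym (m*n/n≡m (length (pairsBelow k)) 2)) (/-congˡ (length-pairsBelow k-1))
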